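{- Let $n\ge 3$ and let $C_n$ be the cycle on $n$ vertices. Then $$sn(C_n)=\begin{cases}1 & \text{if } n \text{ is even},\\ \frac{n+1}{2} & \text{otherwise.}\end{cases}$$
   Context: Graphs are finite, undirected and simple. Let $G=(V,E)$ be a connected graph with chromatic number $\chi(G)=k\ge 2$. For $S\subset V$, a partial coloring on $G[S]$ is a proper coloring $\mathscr C_0$ of the induced subgraph $G[S]$ with colors from $\{1,\dots,k\}$ (not all colors need be used). It is a Sudoku coloring of $G$ if there is exactly one proper $k$-coloring $V\to\{1,\dots,k\}$ of $G$ whose restriction to $S$ is $\mathscr C_0$. The Sudoku number $sn(G)$ is the smallest $|S|$ such that $G[S]$ admits a Sudoku coloring of $G$. -}

module Defs where

open import Data.Fin using (Fin; toℕ)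
open import Data.Fin.Subset using (Subset; _∈_; ∣_∣)
open import Data.Nat using (ℕ; suc; _≤_; s≤s)
open import Data.Nat.Properties using (1+n≢n)
open import Data.Product using (∃; ∃-syntax; ∃!; _×_; _,_; proj₁)
open import Data.Sum using (_⊎_; inj₁; inj₂; swap)
open import Function using (_∘_; _on_)
open import Level using (0ℓ)
open import Relation.Binary using (Rel; Symmetric; Irreflexive)
open import Relation.Binary.PropositionalEquality using (_≡_; _≢_; _≗_; refl; cong; trans; sym)
open import Relation.Nullary using (¬_)

-- A finite graph is a Graph (Fin n). General vertex types are allowed so that
-- induced subgraphs are again graphs.
record Graph (V : Set) : Set₁ where
  field
    Adj        : Rel V 0ℓ
    adj-sym    : Symmetric Adj
    adj-irrefl : Irreflexive _≡_ Adj

open Graph public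

induced : ∀ {n} → Graph (Fin n) → (S : Subset n) → Graph (∃ λ v → v ∈ S)
induced G S = record
  { Adj        = Adj G on proj₁
  ; adj-sym    = adj-sym G
  ; adj-irrefl = λ eq → adj-irrefl G (cong proj₁ eq)
  }

Coloring : Set → ℕ → Set
Coloring V k = V → Fin k

Proper : ∀ {V k} → Graph V → Coloring V k → Set
Proper G c = ∀ {u v} → Adj G u v → c u ≢ c v

IsLeast : (ℕ → Set) → ℕ → Set
IsLeast P m = P m × (∀ {j} → P j → m ≤ j)

IsChromaticNumber : ∀ {V} → Graph V → ℕ → Set
IsChromaticNumber {V} G = IsLeast λ k → ∃[ c ] Proper {V} {k} G c

-- Uniqueness of the extension is up to pointwise equality of functions.
IsSudokuColoring : ∀ {n k} (G : Graph (Fin n)) (S : Subset n) →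
                   Coloring (∃ λ v → v ∈ S) k → Set
IsSudokuColoring {n} {k} G S c₀ =
  Proper (induced G S) c₀ ×
  ∃! _≗_ (λ (c : Coloring (Fin n) k) → Proper G c × c ∘ proj₁ ≗ c₀)

-- sn(G) ≡ s, as a relation. The definition makes sense for every finite graph,
-- so it does not carry the assumptions that G is connected and χ(G) ≥ 2.
IsSudokuNumber : ∀ {n} → Graph (Fin n) → ℕ → Set
IsSudokuNumber {n} G s =
  ∃[ k ] IsChromaticNumber G k ×
         IsLeast (λ m → ∃[ S ] ∣ S ∣ ≡ m ×
                        (∃[ c₀ ] IsSudokuColoring {n} {k} G S c₀)) s

-- j ≡ i + 1 modulo n.
Next : ∀ {n} → Fin n → Fin n → Set
Next {n} i j = suc (toℕ i) ≡ toℕ j ⊎ (suc (toℕ i) ≡ n × toℕ j ≡ 0)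

Next-irrefl : ∀ {n} → 3 ≤ n → (i : Fin n) → ¬ Next i i
Next-irrefl _ i (inj₁ eq) = 1+n≢n eq
Next-irrefl (s≤s (s≤s _)) i (inj₂ (last , first)) with trans (sym (cong suc first)) last
... | ()

cycle : ∀ n → 3 ≤ n → Graph (Fin n)
cycle n 3≤n = record
  { Adj        = λ i j → Next i j ⊎ Next j i
  ; adj-sym    = swap
  ; adj-irrefl = λ { {i} refl (inj₁ e) → Next-irrefl 3≤n i e
                   ; {i} refl (inj₂ e) → Next-irrefl 3≤n i e }
  }

{-# OPTIONS --safe #-}
-- An even cycle is 2-chromatic, and a 2-colouring of it is determined by the
-- colour of any vertex. An odd cycle is 3-chromatic. If two consecutive
-- vertices of it are left uncoloured, then, whatever the colours of their outer
-- neighbours, the pair can be recoloured in at least two ways; so the set S of a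
-- Sudoku colouring covers every edge and has at least (n + 1) / 2 elements.
-- Conversely, colour the even positions 0, 2, …, n ∸ 1 so that (cyclically)
-- consecutive ones differ: every odd position then has a single colour left.
module Submission where

open import Defs
open import Data.Bool using (true; false)
open import Data.Fin using (Fin; zero; suc; toℕ; fromℕ; fromℕ<; inject₁; inject≤; opposite)
open import Data.Fin.Induction using (<-weakInduction)
open import Data.Fin.Patterns using (0F; 1F; 2F)
open import Data.Fin.Properties
  using (_≟_; all?; any?; toℕ-injective; toℕ-fromℕ; toℕ-fromℕ<; toℕ-inject₁; toℕ<n;
         inject≤-injective; opposite-involutive)
open import Data.Fin.Subset using (Subset; Side; inside; outside; _∈_; _∉_; ∣_∣; ⁅_⁆; _-_)
open import Data.Fin.Subset.Properties
  using (_∈?_; drop-there; x∈⁅x⁆; ∣⁅x⁆∣≡1; x∈p⇒∣p-x∣<∣p∣)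
import Data.Nat as ℕ
open import Data.Nat using (ℕ; zero; suc; _+_; _*_; _≤_; _<_; _/_; _%_; z≤n; s≤s)
open import Data.Nat.Divisibility using (_∣_; divides)
open import Data.Nat.DivMod using (m≡m%n+[m/n]*n; m%n<n; m*n/n≡m)
open import Data.Nat.Properties
  using (≤-trans; ≤∧≢⇒<; ≰⇒>; m≤n⇒m≤1+n; *-cancelʳ-<; *-monoˡ-≤;
         +-comm; <-irrefl; suc-injective; n≢0⇒n>0; n<1+n; n≤1+n)
open import Data.Product using (∃; ∃-syntax; _×_; _,_; proj₁)
open import Data.Sum using (_⊎_; inj₁; inj₂; [_,_])
open import Data.Vec using ([]; _∷_; here; there)
open import Function using (_∘_)
open import Relation.Binary.PropositionalEquality
  using (_≡_; _≢_; refl; sym; trans; cong; subst; ≢-sym)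
open import Relation.Nullary using (¬_; yes; no; contradiction)
open import Relation.Nullary.Decidable using (from-yes; ¬?; _×-dec_; _⊎-dec_; _→-dec_)

private
  variable
    n m k : ℕ

-- Successors and predecessors along the cycle

next : (i : Fin (suc m)) → ∃ (Next i)
next {m} i with toℕ i ℕ.≟ m
... | yes i≡m = zero , inj₂ (cong suc i≡m , refl)
... | no  i≢m = fromℕ< i<m , inj₁ (sym (toℕ-fromℕ< i<m))
  where i<m = s≤s (≤∧≢⇒< (ℕ.s≤s⁻¹ (toℕ<n i)) i≢m)

prev : (j : Fin (suc m)) → ∃ λ i → Next i j
prev {m}     zero    = fromℕ m , inj₂ (cong suc (toℕ-fromℕ m) , refl)
prev {suc m} (suc j) = inject₁ j , inj₁ (cong suc (toℕ-inject₁ j))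

Next-functional : {i j j′ : Fin n} → Next i j → Next i j′ → j ≡ j′
Next-functional (inj₁ e) (inj₁ e′) = toℕ-injective (trans (sym e) e′)
Next-functional {j = j} (inj₁ e) (inj₂ (l , _)) =
  contradiction (toℕ<n j) (<-irrefl (trans (sym e) l))
Next-functional {j′ = j′} (inj₂ (l , _)) (inj₁ e) =
  contradiction (toℕ<n j′) (<-irrefl (trans (sym e) l))
Next-functional (inj₂ (_ , z)) (inj₂ (_ , z′)) = toℕ-injective (trans z (sym z′))

Next-injective : {i i′ j : Fin n} → Next i j → Next i′ j → i ≡ i′
Next-injective (inj₁ e) (inj₁ e′) = toℕ-injective (suc-injective (trans e (sym e′)))
Next-injective (inj₁ e) (inj₂ (_ , z)) = contradiction (trans e z) λ ()
Next-injective (inj₂ (_ , z)) (inj₁ e) = contradiction (trans e z) λ ()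
Next-injective (inj₂ (l , _)) (inj₂ (l′ , _)) =
  toℕ-injective (suc-injective (trans l (sym l′)))

-- Two steps forward lead back to the start only on a cycle with at most two vertices: crossing the
-- closing edge once forces `n` to be 2, crossing it twice forces 1.
Next-asym : 3 ≤ n → {i j : Fin n} → Next i j → ¬ Next j i
Next-asym 3≤n {i} (inj₁ e) (inj₁ e′) =
  <-irrefl (trans (sym e′) (cong suc (sym e))) (m≤n⇒m≤1+n (n<1+n (toℕ i)))
Next-asym 3≤n (inj₁ e) (inj₂ (l , z)) =
  <-irrefl (trans (cong (λ x → suc (suc x)) (sym z)) (trans (cong suc e) l)) 3≤n
Next-asym 3≤n (inj₂ (l , z)) (inj₁ e) =
  <-irrefl (trans (cong (λ x → suc (suc x)) (sym z)) (trans (cong suc e) l)) 3≤n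
Next-asym 3≤n (inj₂ (_ , z)) (inj₂ (l , _)) =
  <-irrefl (trans (cong suc (sym z)) l) (≤-trans (n≤1+n 2) 3≤n)

cycle-proper : (3≤n : 3 ≤ n) {c : Coloring (Fin n) k} →
               (∀ {i j} → Next i j → c i ≢ c j) → Proper (cycle n 3≤n) c
cycle-proper _ step (inj₁ e) = step e
cycle-proper _ step (inj₂ e) = ≢-sym (step e)

cycle-proper-ℕ : (3≤n : 3 ≤ suc m) (f : ℕ → Fin k) →
                 (∀ i → f i ≢ f (suc i)) → f m ≢ f 0 →
                 Proper (cycle (suc m) 3≤n) (f ∘ toℕ)
cycle-proper-ℕ {m = m} 3≤n f step wrap = cycle-proper 3≤n next-≢
  where
  next-≢ : {i j : Fin (suc m)} → Next i j → f (toℕ i) ≢ f (toℕ j)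
  next-≢ {i} (inj₁ e) eq   = step (toℕ i) (trans eq (cong f (sym e)))
  next-≢ (inj₂ (l , z)) eq = wrap (trans (cong f (sym (suc-injective l))) (trans eq (cong f z)))

-- Chromatic numbers and determining sets

module _ {V : Set} (G : Graph V) where

  embed-colours : ∀ {j k} → j ≤ k → ∃[ c ] Proper {V} {j} G c → ∃[ c ] Proper {V} {k} G c
  embed-colours j≤k (c , c-proper) =
    (λ v → inject≤ (c v) j≤k) , λ uv eq → c-proper uv (inject≤-injective j≤k j≤k _ _ eq)

  -- Leastness has to be tested only just below: a colouring with fewer colours is, after
  -- `embed-colours`, also one with `k`.
  chromatic : (∃[ c ] Proper {V} {suc k} G c) → ¬ (∃[ c ] Proper {V} {k} G c) →
              IsChromaticNumber G (suc k)
  chromatic colourable uncolourable =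
    colourable , λ j-col → ≰⇒> λ j≤k → uncolourable (embed-colours j≤k j-col)

module _ (G : Graph (Fin n)) where

  -- A Sudoku colouring is the restriction of its own unique extension, so partial colourings can be
  -- traded for a full colouring `c` that is unique relative to its values on `S`.
  Determines : Subset n → Coloring (Fin n) k → Set
  Determines S c = ∀ c′ → Proper G c′ → (∀ {v} → v ∈ S → c v ≡ c′ v) → ∀ v → c v ≡ c′ v

  sudoku⇒determined : {S : Subset n} {c₀ : Coloring (∃ λ v → v ∈ S) k} →
                      IsSudokuColoring G S c₀ →
                      ∃[ c ] Proper G c × Determines S c
  sudoku⇒determined (_ , c , (c-proper , c≗c₀) , unique) =
    c , c-proper , λ c′ c′-proper agree →
      unique (c′-proper , λ (v , v∈S) → trans (sym (agree v∈S)) (c≗c₀ (v , v∈S)))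

  determined⇒sudoku : {S : Subset n} (c : Coloring (Fin n) k) → Proper G c → Determines S c →
                      IsSudokuColoring G S (c ∘ proj₁)
  determined⇒sudoku c c-proper determines =
    (λ uv → c-proper uv) , c , (c-proper , λ _ → refl) ,
    λ {c′} (c′-proper , agree) → determines c′ c′-proper (λ {v} v∈S → sym (agree (v , v∈S)))

-- Even cycles

alternating : Fin 2 → ℕ → Fin 2
alternating a zero    = a
alternating a (suc i) = opposite (alternating a i)

opposite-≢ : (a : Fin 2) → a ≢ opposite a
opposite-≢ 0F ()
opposite-≢ 1F ()

≢⇒opposite : (a b : Fin 2) → a ≢ b → b ≡ opposite a
≢⇒opposite 0F 0F a≢b = contradiction refl a≢b
≢⇒opposite 0F 1F a≢b = refl
≢⇒opposite 1F 0F a≢b = refl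
≢⇒opposite 1F 1F a≢b = contradiction refl a≢b

alternating-even : ∀ a k → alternating a (k * 2) ≡ a
alternating-even a zero    = refl
alternating-even a (suc k) =
  trans (opposite-involutive (alternating a (k * 2))) (alternating-even a k)

-- Induction along the path from `zero`: with two colours, each edge forces the colour of its far
-- end.
2-colouring-alternates : (3≤n : 3 ≤ suc m) (c : Coloring (Fin (suc m)) 2) →
                         Proper (cycle (suc m) 3≤n) c →
                         ∀ i → c i ≡ alternating (c zero) (toℕ i)
2-colouring-alternates 3≤n c c-proper = <-weakInduction
  (λ i → c i ≡ alternating (c zero) (toℕ i)) refl
  λ i ih → trans
    (≢⇒opposite _ _ (c-proper (inj₁ (inj₁ (cong suc (toℕ-inject₁ i))))))
    (cong opposite (trans ih (cong (alternating (c zero)) (toℕ-inject₁ i))))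

cycle-not-1-colourable : (3≤n : 3 ≤ n) → ¬ (∃[ c ] Proper {k = 1} (cycle n 3≤n) c)
cycle-not-1-colourable (s≤s (s≤s _)) (c , c-proper) =
  c-proper {0F} {1F} (inj₁ (inj₁ refl)) (Fin1-unique (c 0F) (c 1F))
  where
  Fin1-unique : (a b : Fin 1) → a ≡ b
  Fin1-unique 0F 0F = refl

even-proper : ∀ k (3≤n : 3 ≤ suc k * 2) →
              Proper (cycle (suc k * 2) 3≤n) (alternating 0F ∘ toℕ)
even-proper k 3≤n = cycle-proper-ℕ 3≤n (alternating 0F) (λ i → opposite-≢ _)
  -- The last position is `suc (k * 2)`, which is odd, so its colour is opposite to that of position
  -- 0.
  (subst (λ a → opposite a ≢ 0F) (sym (alternating-even 0F k)) λ ())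

-- If `S` were empty, exchanging the two colours everywhere would give a second extension.
even-lower : (3≤n : 3 ≤ suc m) (S : Subset (suc m)) {c₀ : Coloring (∃ λ v → v ∈ S) 2} →
             IsSudokuColoring (cycle (suc m) 3≤n) S c₀ → 1 ≤ ∣ S ∣
even-lower {m} 3≤n S sudoku = n≢0⇒n>0 λ ∣S∣≡0 →
  let c , c-proper , determines = sudoku⇒determined (cycle _ 3≤n) sudoku
      empty : ∀ {v} → v ∉ S
      empty {v} v∈S = contradiction (subst (∣ S - v ∣ <_) ∣S∣≡0 (x∈p⇒∣p-x∣<∣p∣ {x = v} v∈S)) λ ()
      flipped-proper : Proper (cycle (suc m) 3≤n) (opposite ∘ c)
      flipped-proper uv eq = c-proper uv
        (trans (sym (opposite-involutive _)) (trans (cong opposite eq) (opposite-involutive _)))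
  in opposite-≢ (c zero)
       (determines (opposite ∘ c) flipped-proper (λ v∈S → contradiction v∈S empty) zero)

sn-even : ∀ k (3≤n : 3 ≤ suc k * 2) → IsSudokuNumber (cycle (suc k * 2) 3≤n) 1
sn-even k 3≤n =
  2 ,
  chromatic (cycle _ 3≤n) (c , even-proper k 3≤n) (cycle-not-1-colourable 3≤n) ,
  (⁅ zero ⁆ , ∣⁅x⁆∣≡1 {suc k * 2} zero , _ ,
    determined⇒sudoku (cycle _ 3≤n) c (even-proper k 3≤n) determines) ,
  λ { (S , refl , _ , sudoku) → even-lower 3≤n S sudoku }
  where
  c = alternating 0F ∘ toℕ
  determines : Determines (cycle _ 3≤n) ⁅ zero ⁆ c
  determines c′ c′-proper agree v = trans
    (cong (λ a → alternating a (toℕ v)) (agree (x∈⁅x⁆ zero)))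
    (sym (2-colouring-alternates 3≤n c′ c′-proper v))

-- Odd cycles

-- The last position `k * 2` is even, so alternation would give it the colour of its neighbour
-- `zero`.
odd-not-2-colourable : ∀ k (3≤n : 3 ≤ suc (k * 2)) →
                       ¬ (∃[ c ] Proper {k = 2} (cycle (suc (k * 2)) 3≤n) c)
odd-not-2-colourable k 3≤n (c , c-proper) =
  c-proper {fromℕ (k * 2)} {zero} (inj₁ (inj₂ (cong suc (toℕ-fromℕ (k * 2)) , refl)))
    (trans (2-colouring-alternates 3≤n c c-proper (fromℕ (k * 2)))
           (trans (cong (alternating (c zero)) (toℕ-fromℕ (k * 2)))
                  (alternating-even (c zero) k)))

-- There are four pairs with `x` different from `a` and `y` different from `d`. At most two of them
-- have `x` equal to `y`, so at least two proper choices remain and one differs from the present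
-- pair. The code checks all cases by decision.
recolour-pair : (a b c d : Fin 3) → a ≢ b → b ≢ c → c ≢ d →
                ∃[ x ] ∃[ y ] a ≢ x × x ≢ y × y ≢ d × (b ≢ x ⊎ c ≢ y)
recolour-pair = from-yes (all? {3} λ a → all? λ b → all? λ c → all? λ d →
  ¬? (a ≟ b) →-dec (¬? (b ≟ c) →-dec (¬? (c ≟ d) →-dec
  any? λ x → any? λ y → ¬? (a ≟ x) ×-dec (¬? (x ≟ y) ×-dec (¬? (y ≟ d) ×-dec
    (¬? (b ≟ x) ⊎-dec ¬? (c ≟ y)))))))

third-colour-unique : (a b x y : Fin 3) → a ≢ b →
                      a ≢ x → x ≢ b → a ≢ y → y ≢ b → x ≡ y
third-colour-unique = from-yes (all? {3} λ a → all? λ b → all? λ x → all? λ y →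
  ¬? (a ≟ b) →-dec (¬? (a ≟ x) →-dec (¬? (x ≟ b) →-dec
  (¬? (a ≟ y) →-dec (¬? (y ≟ b) →-dec (x ≟ y))))))

module _ (c : Coloring (Fin n) k) (u v : Fin n) (x y : Fin k) where

  recolour : Coloring (Fin n) k
  recolour i with i ≟ u | i ≟ v
  ... | yes _ | _     = x
  ... | no  _ | yes _ = y
  ... | no  _ | no  _ = c i

  recolour-u : recolour u ≡ x
  recolour-u with u ≟ u
  ... | yes _  = refl
  ... | no u≢u = contradiction refl u≢u

  recolour-v : u ≢ v → recolour v ≡ y
  recolour-v u≢v with v ≟ u | v ≟ v
  ... | yes v≡u | _      = contradiction (sym v≡u) u≢v
  ... | no _    | yes _  = refl
  ... | no _    | no v≢v = contradiction refl v≢v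

  recolour-other : ∀ {i} → i ≢ u → i ≢ v → recolour i ≡ c i
  recolour-other {i} i≢u i≢v with i ≟ u | i ≟ v
  ... | yes i≡u | _       = contradiction i≡u i≢u
  ... | no _    | yes i≡v = contradiction i≡v i≢v
  ... | no _    | no _    = refl

  -- Only the edges `pu`, `uv` and `vw` meet the recoloured pair: `Next-injective` and
  -- `Next-functional` identify any edge entering or leaving it with one of these, and every other
  -- edge keeps its old colours.
  recolour-proper : (3≤n : 3 ≤ n) → Proper (cycle n 3≤n) c →
                    ∀ {p w} → Next p u → Next u v → Next v w →
                    c p ≢ x → x ≢ y → y ≢ c w → Proper (cycle n 3≤n) recolour
  recolour-proper 3≤n c-proper pu uv vw cp≢x x≢y y≢cw = cycle-proper 3≤n step
    where
    step : ∀ {i j} → Next i j → recolour i ≢ recolour j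
    step {i} {j} ij with i ≟ u | i ≟ v | j ≟ u | j ≟ v
    ... | yes refl | _        | yes refl | _        = contradiction ij (Next-irrefl 3≤n _)
    ... | yes refl | _        | no _     | yes refl = x≢y
    ... | yes refl | _        | no _     | no j≢v   = contradiction (Next-functional ij uv) j≢v
    ... | no _     | yes refl | yes refl | _        = contradiction ij (Next-asym 3≤n uv)
    ... | no _     | yes refl | no _     | yes refl = contradiction ij (Next-irrefl 3≤n _)
    ... | no _     | yes refl | no _     | no _     =
      subst (λ j → y ≢ c j) (Next-functional vw ij) y≢cw
    ... | no _     | no _     | yes refl | _        =
      subst (λ i → c i ≢ x) (Next-injective pu ij) cp≢x
    ... | no i≢u   | no _     | no _     | yes refl = contradiction (Next-injective ij uv) i≢u
    ... | no _     | no _     | no _     | no _     = c-proper (inj₁ ij)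

sudoku-covers-edges : (3≤n : 3 ≤ suc m) (S : Subset (suc m))
                      {c₀ : Coloring (∃ λ v → v ∈ S) 3} →
                      IsSudokuColoring (cycle (suc m) 3≤n) S c₀ →
                      ∀ {u v} → Next u v → u ∈ S ⊎ v ∈ S
sudoku-covers-edges 3≤n S sudoku {u} {v} uv with u ∈? S | v ∈? S
... | yes u∈S | _       = inj₁ u∈S
... | no _    | yes v∈S = inj₂ v∈S
... | no u∉S  | no v∉S  =
  let c , c-proper , determines = sudoku⇒determined (cycle _ 3≤n) sudoku
      -- In a triangle `p` and `w` are the same vertex; `recolour-pair` allows equal outer colours.
      p , pu = prev u
      w , vw = next v
      x , y , cp≢x , x≢y , y≢cw , differs =
        recolour-pair (c p) (c u) (c v) (c w)
          (c-proper (inj₁ pu)) (c-proper (inj₁ uv)) (c-proper (inj₁ vw))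
      u≢v : u ≢ v
      u≢v u≡v = Next-irrefl 3≤n u (subst (Next u) (sym u≡v) uv)
      same = determines (recolour c u v x y)
        (recolour-proper c u v x y 3≤n c-proper pu uv vw cp≢x x≢y y≢cw)
        λ i∈S → sym (recolour-other c u v x y
          (λ { refl → u∉S i∈S }) (λ { refl → v∉S i∈S }))
  in contradiction differs
       [ (λ cu≢x → cu≢x (trans (same u) (recolour-u c u v x y)))
       , (λ cv≢y → cv≢y (trans (same v) (recolour-v c u v x y u≢v))) ]

-- Size of a vertex cover of an odd cycle

CoversPath : Subset n → Set
CoversPath S = ∀ {i j} → suc (toℕ i) ≡ toℕ j → i ∈ S ⊎ j ∈ S

-- Deleting the first vertex of a path leaves a path, whereas it would break a cycle; hence the
-- counting inductions run on paths.
coversPath-tail : {s : Side} {S : Subset n} → CoversPath (s ∷ S) → CoversPath S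
coversPath-tail covers {i} {j} e with covers {suc i} {suc j} (cong suc e)
... | inj₁ i∈S = inj₁ (drop-there i∈S)
... | inj₂ j∈S = inj₂ (drop-there j∈S)

coversPath-two : {s t : Side} {S : Subset n} → CoversPath (s ∷ t ∷ S) →
                 k ≤ ∣ S ∣ → suc k ≤ ∣ s ∷ t ∷ S ∣
coversPath-two {s = true}  {true}  _ k≤ = m≤n⇒m≤1+n (s≤s k≤)
coversPath-two {s = true}  {false} _ k≤ = s≤s k≤
coversPath-two {s = false} {true}  _ k≤ = s≤s k≤
coversPath-two {s = false} {false} covers k≤ with covers {0F} {1F} refl
... | inj₁ ()
... | inj₂ (there ())

coversPath-even : ∀ k (S : Subset (k * 2)) → CoversPath S → k ≤ ∣ S ∣
coversPath-even zero    S           covers = z≤n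
coversPath-even (suc k) (s ∷ t ∷ S) covers = coversPath-two {s = s} {t} covers
  (coversPath-even k S (coversPath-tail {s = t} (coversPath-tail {s = s} covers)))

-- The first `k * 2` vertices split into `k` disjoint edges, each containing an element of `S`; the
-- last vertex contributes one more.
coversPath-last : ∀ k (S : Subset (suc (k * 2))) → CoversPath S →
                  fromℕ (k * 2) ∈ S → suc k ≤ ∣ S ∣
coversPath-last zero    (_ ∷ [])    covers here = s≤s z≤n
coversPath-last (suc k) (s ∷ t ∷ S) covers (there (there last∈S)) =
  coversPath-two {s = s} {t} covers
    (coversPath-last k S (coversPath-tail {s = t} (coversPath-tail {s = s} covers)) last∈S)

-- The closing edge has an end in `S`. Count that end separately; the other `k * 2` vertices form a
-- path with `k` disjoint edges.
coversCycle : ∀ k (S : Subset (suc (k * 2))) →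
              (∀ {i j} → Next i j → i ∈ S ⊎ j ∈ S) → suc k ≤ ∣ S ∣
coversCycle k (s ∷ S) covers
  with covers {fromℕ (k * 2)} {zero} (inj₂ (cong suc (toℕ-fromℕ (k * 2)) , refl))
... | inj₁ last∈S = coversPath-last k (s ∷ S) (covers ∘ inj₁) last∈S
... | inj₂ here   = s≤s (coversPath-even k S (coversPath-tail {s = s} (covers ∘ inj₁)))

-- An optimal set and its colouring

evens : ∀ n → Subset n
evens zero          = []
evens (suc zero)    = inside ∷ []
evens (suc (suc n)) = inside ∷ outside ∷ evens n

∣evens∣ : ∀ k → ∣ evens (suc (k * 2)) ∣ ≡ suc k
∣evens∣ zero    = refl
∣evens∣ (suc k) = cong suc (∣evens∣ k)

even∈evens : ∀ k {i : Fin n} → toℕ i ≡ k * 2 → i ∈ evens n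
even∈evens {suc zero}    zero    {zero} _ = here
even∈evens {suc (suc n)} zero    {zero} _ = here
even∈evens {suc (suc n)} (suc k) {suc (suc i)} e =
  there (there (even∈evens k (suc-injective (suc-injective e))))

-- 2,0 followed by the period 1,2,0,2: the even positions read 2,1,0,1,0,…
oddColour : ℕ → Fin 3
oddColour 0 = 2F
oddColour 1 = 0F
oddColour 2 = 1F
oddColour 3 = 2F
oddColour 4 = 0F
oddColour 5 = 2F
oddColour (suc (suc (suc (suc i@(suc (suc _)))))) = oddColour i

oddColour-step : ∀ i → oddColour i ≢ oddColour (suc i)
oddColour-step 0 ()
oddColour-step 1 ()
oddColour-step 2 ()
oddColour-step 3 ()
oddColour-step 4 ()
oddColour-step 5 ()
oddColour-step (suc (suc (suc (suc i@(suc (suc _)))))) = oddColour-step i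

-- This is what makes the even positions decisive: two different colours around an odd position
-- leave it only the third.
oddColour-even-step : ∀ k → oddColour (k * 2) ≢ oddColour (suc k * 2)
oddColour-even-step 0 ()
oddColour-even-step 1 ()
oddColour-even-step 2 ()
oddColour-even-step (suc (suc k@(suc _))) = oddColour-even-step k

-- Among even positions colour 2 occurs only at 0, so the closing edge is proper whether the number
-- of even positions is even or odd.
oddColour-wrap : ∀ k → oddColour (suc k * 2) ≢ oddColour 0
oddColour-wrap 0 ()
oddColour-wrap 1 ()
oddColour-wrap (suc (suc k)) = oddColour-wrap k

odd-proper : ∀ k (3≤n : 3 ≤ suc (suc k * 2)) →
             Proper (cycle (suc (suc k * 2)) 3≤n) (oddColour ∘ toℕ)
odd-proper k 3≤n = cycle-proper-ℕ 3≤n oddColour oddColour-step (oddColour-wrap k)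

even-or-odd : ∀ n → (∃[ k ] n ≡ k * 2) ⊎ (∃[ k ] n ≡ suc (k * 2))
even-or-odd n with n % 2 | m≡m%n+[m/n]*n n 2 | m%n<n n 2
... | 0           | eq | _ = inj₁ (n / 2 , eq)
... | 1           | eq | _ = inj₂ (n / 2 , eq)
... | suc (suc _) | _  | s≤s (s≤s ())

evens-determine : ∀ k (3≤n : 3 ≤ suc (k * 2)) →
                  Proper (cycle (suc (k * 2)) 3≤n) (oddColour ∘ toℕ) →
                  Determines (cycle _ 3≤n) (evens _) (oddColour ∘ toℕ)
evens-determine k 3≤n c-proper c′ c′-proper agree i with even-or-odd (toℕ i)
... | inj₁ (h , eq) = agree (even∈evens h eq)
... | inj₂ (h , eq) = third-colour-unique (c p) (c q) (c i) (c′ i)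
        (λ cp≡cq → oddColour-even-step h
          (trans (cong oddColour (sym p≡)) (trans cp≡cq (cong oddColour q≡))))
        (c-proper (inj₁ pi)) (c-proper (inj₁ iq))
        (subst (_≢ c′ i) (sym (agree (even∈evens h p≡))) (c′-proper (inj₁ pi)))
        (subst (c′ i ≢_) (sym (agree (even∈evens (suc h) q≡))) (c′-proper (inj₁ iq)))
  where
  c = oddColour ∘ toℕ
  -- The last position is even, so the odd position `i` is not last and its right neighbour is
  -- reached without wrapping around.
  q< : suc h * 2 < suc (k * 2)
  q< = s≤s (*-monoˡ-≤ 2 (*-cancelʳ-< 2 h k
         (ℕ.s≤s⁻¹ (subst (_< suc (k * 2)) eq (toℕ<n i)))))
  p< : h * 2 < suc (k * 2)
  p< = ≤-trans (m≤n⇒m≤1+n (n≤1+n _)) q<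
  p = fromℕ< p<
  q = fromℕ< q<
  p≡ = toℕ-fromℕ< p<
  q≡ = toℕ-fromℕ< q<
  pi : Next p i
  pi = inj₁ (trans (cong suc p≡) (sym eq))
  iq : Next i q
  iq = inj₁ (trans (cong suc eq) (sym q≡))

sn-odd : ∀ k (3≤n : 3 ≤ suc (suc k * 2)) →
         IsSudokuNumber (cycle (suc (suc k * 2)) 3≤n) (suc (suc k))
sn-odd k 3≤n =
  3 ,
  chromatic (cycle _ 3≤n) (oddColour ∘ toℕ , odd-proper k 3≤n) (odd-not-2-colourable (suc k) 3≤n) ,
  (evens _ , ∣evens∣ (suc k) , _ ,
    determined⇒sudoku (cycle _ 3≤n) (oddColour ∘ toℕ) (odd-proper k 3≤n)
      (evens-determine (suc k) 3≤n (odd-proper k 3≤n))) ,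
  λ { (S , refl , _ , sudoku) → coversCycle (suc k) S (sudoku-covers-edges 3≤n S sudoku) }

theorem3p5 : (n : ℕ) (3≤n : 3 ≤ n) →
    (2 ∣ n → IsSudokuNumber (cycle n 3≤n) 1) ×
    (¬ (2 ∣ n) → IsSudokuNumber (cycle n 3≤n) ((n + 1) / 2))
theorem3p5 n 3≤n = even , odd
  where
  even : 2 ∣ n → IsSudokuNumber (cycle n 3≤n) 1
  -- A zero quotient would make `n` zero, against `3≤n`.
  even (divides (suc k) refl) = sn-even k 3≤n
  odd : ¬ (2 ∣ n) → IsSudokuNumber (cycle n 3≤n) ((n + 1) / 2)
  odd 2∤n with even-or-odd n
  ... | inj₁ (k , eq) = contradiction (divides k eq) 2∤n
  ... | inj₂ (zero , refl) = contradiction 3≤n λ { (s≤s ()) }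
  -- Here `1 + n` computes to `suc (suc k) * 2`, whose half is the bound of `sn-odd`.
  ... | inj₂ (suc k , refl) = subst (IsSudokuNumber (cycle n 3≤n))
        (sym (trans (cong (_/ 2) (+-comm n 1)) (m*n/n≡m (suc (suc k)) 2)))
        (sn-odd k 3≤n)
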